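{- Let $p:\mathcal{E}\to\mathcal{B}$ be a fibration with codes (so $\mathcal B$ has binary products and a chosen terminal object $1$, and $p$ is a cloven fibration equipped with a code structure). Suppose that there exist an object $A\in\mathcal{B}$ and a morphism $i:\ulcorner\mathcal{E}_A\urcorner\to A$ in $\mathcal B$ such that the reindexing functor $i^*:\mathcal{E}_A\to\mathcal{E}_{\ulcorner\mathcal{E}_A\urcorner}$ is essentially surjective. Then, for any object $P\in\mathcal{E}_{\ulcorner\mathcal{E}_1\urcorner}$, there exists an object $X\in\mathcal{E}_1$ such that $P\cdot\ulcorner X\urcorner\cong X$ holds in $\mathcal{E}_1$.
   Context: For a cloven fibration $p:\mathcal E\to\mathcal B$ (a Grothendieck fibration with chosen Cartesian liftings), $\mathcal E_A$ is the fiber category over $A$, $f^*:\mathcal E_B\to\mathcal E_A$ is the reindexing functor along $f:A\to B$, and $X\cdot f$ means $f^*(X)$ (read $X\cdot f\cdot g$ as $(X\cdot f)\cdot g$). A global element $a\in_1 A$ is a morphism $a:1\to A$; for $f:A\to B$, $f(a)=f\circ a$, and $f(a,b)=f\circ\langle a,b\rangle$. Weak equality: for parallel $f,f':A\to B$ in $\mathcal B$ (with finite products), $f\approx f'$ means that the reindexing functors along $\langle \mathrm{id},f\rangle,\langle\mathrm{id},f'\rangle:A\to A\times B$ are naturally isomorphic. Code structure: let $p:\mathcal E\to\mathcal B$ be a cloven fibration over a category $\mathcal B$ with binary products and a chosen terminal object $1$. A code structure on $p$ consists of: (i) for each $A\in\mathcal B$ an object $\ulcorner\mathcal E_A\urcorner\in\mathcal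 B$, and for each $X\in\mathcal E_A$ a global element $\ulcorner X\urcorner\in_1\ulcorner\mathcal E_A\urcorner$; (ii) for each $A,B\in\mathcal B$ an object $\ulcorner\mathcal B(A,B)\urcorner\in\mathcal B$, and for each $f:A\to B$ a global element $\ulcorner f\urcorner\in_1\ulcorner\mathcal B(A,B)\urcorner$; (iii) for each $A,B\in\mathcal B$ a morphism $\mathsf{app}_{A,B}:\ulcorner\mathcal E_B\urcorner\times\ulcorner\mathcal B(A,B)\urcorner\to\ulcorner\mathcal E_A\urcorner$ such that $\mathsf{app}_{A,B}(\ulcorner X\urcorner,\ulcorner f\urcorner)\approx\ulcorner X\cdot f\urcorner$ for all $X\in\mathcal E_B$, $f:A\to B$; (iv) for each $A\in\mathcal B$ a morphism $\mathsf{code}_A:\ulcorner\mathcal E_A\urcorner\to\ulcorner\mathcal B(1,\ulcorner\mathcal E_A\urcorner)\urcorner$ such that $\mathsf{code}_A(\ulcorner X\urcorner)\approx\ulcorner\ulcorner X\urcorner\urcorner$ for all $X\in\mathcal E_A$ (the right-hand side is (ii) applied to the morphism $\ulcorner X\urcorner:1\to\ulcorner\mathcal E_A\urcorner$). A fibration with codes is a cloven fibration equipped with a code structure. -}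

module Defs where

open import Level using (Level; _⊔_) renaming (suc to lsuc)
open import Data.Product using (_,_; _×_; Σ-syntax; ∃-syntax; proj₁; proj₂)
open import Relation.Binary.Structures using (IsEquivalence)
open import Relation.Binary.PropositionalEquality using (_≡_; refl; subst₂)

-- Hom-sets are setoids; equality of objects, which is needed to say that an
-- object of the total category lies over a given object, is propositional.
record Category (o ℓ e : Level) : Set (lsuc (o ⊔ ℓ ⊔ e)) where
  infix  4 _≈_ _⇒_
  infixr 9 _∘_
  field
    Obj       : Set o
    _⇒_       : Obj → Obj → Set ℓ
    _≈_       : ∀ {A B} → A ⇒ B → A ⇒ B → Set e
    id        : ∀ {A} → A ⇒ A
    _∘_       : ∀ {A B C} → B ⇒ C → A ⇒ B → A ⇒ C
    equiv     : ∀ {A B} → IsEquivalence (_≈_ {A} {B})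
    ∘-resp-≈  : ∀ {A B C} {g g′ : B ⇒ C} {f f′ : A ⇒ B} →
                g ≈ g′ → f ≈ f′ → g ∘ f ≈ g′ ∘ f′
    assoc     : ∀ {A B C D} {f : A ⇒ B} {g : B ⇒ C} {h : C ⇒ D} →
                (h ∘ g) ∘ f ≈ h ∘ (g ∘ f)
    identityˡ : ∀ {A B} {f : A ⇒ B} → id ∘ f ≈ f
    identityʳ : ∀ {A B} {f : A ⇒ B} → f ∘ id ≈ f

  module Equiv {A B : Obj} = IsEquivalence (equiv {A} {B})

  record Iso (A B : Obj) : Set (ℓ ⊔ e) where
    field
      from : A ⇒ B
      to   : B ⇒ A
      isoˡ : to ∘ from ≈ id
      isoʳ : from ∘ to ≈ id

record Terminal {o ℓ e} (𝓒 : Category o ℓ e) : Set (o ⊔ ℓ ⊔ e) where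
  open Category 𝓒
  field
    𝟙        : Obj
    !        : ∀ {A} → A ⇒ 𝟙
    !-unique : ∀ {A} (f : A ⇒ 𝟙) → ! ≈ f

record BinaryProducts {o ℓ e} (𝓒 : Category o ℓ e) : Set (o ⊔ ℓ ⊔ e) where
  open Category 𝓒
  infixr 7 _⊗_
  field
    _⊗_      : Obj → Obj → Obj
    π₁       : ∀ {A B} → A ⊗ B ⇒ A
    π₂       : ∀ {A B} → A ⊗ B ⇒ B
    ⟨_,_⟩    : ∀ {A B C} → C ⇒ A → C ⇒ B → C ⇒ A ⊗ B
    project₁ : ∀ {A B C} {f : C ⇒ A} {g : C ⇒ B} → π₁ ∘ ⟨ f , g ⟩ ≈ f
    project₂ : ∀ {A B C} {f : C ⇒ A} {g : C ⇒ B} → π₂ ∘ ⟨ f , g ⟩ ≈ g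
    unique   : ∀ {A B C} {f : C ⇒ A} {g : C ⇒ B} {h : C ⇒ A ⊗ B} →
               π₁ ∘ h ≈ f → π₂ ∘ h ≈ g → ⟨ f , g ⟩ ≈ h

record Functor {o ℓ e o′ ℓ′ e′} (𝓒 : Category o ℓ e) (𝓓 : Category o′ ℓ′ e′) :
               Set (o ⊔ ℓ ⊔ e ⊔ o′ ⊔ ℓ′ ⊔ e′) where
  private
    module C = Category 𝓒
    module D = Category 𝓓
  field
    F₀           : C.Obj → D.Obj
    F₁           : ∀ {A B} → A C.⇒ B → F₀ A D.⇒ F₀ B
    F-resp-≈     : ∀ {A B} {f g : A C.⇒ B} → f C.≈ g → F₁ f D.≈ F₁ g
    identity     : ∀ {A} → F₁ (C.id {A}) D.≈ D.id
    homomorphism : ∀ {A B C} {f : A C.⇒ B} {g : B C.⇒ C} →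
                   F₁ (g C.∘ f) D.≈ F₁ g D.∘ F₁ f

record NaturalIsomorphism {o ℓ e o′ ℓ′ e′} {𝓒 : Category o ℓ e} {𝓓 : Category o′ ℓ′ e′}
                          (F G : Functor 𝓒 𝓓) : Set (o ⊔ ℓ ⊔ ℓ′ ⊔ e′) where
  private
    module C = Category 𝓒
    module D = Category 𝓓
    module F = Functor F
    module G = Functor G
  field
    component : ∀ X → D.Iso (F.F₀ X) (G.F₀ X)
    natural   : ∀ {X Y} (f : X C.⇒ Y) →
                D.Iso.from (component Y) D.∘ F.F₁ f D.≈ G.F₁ f D.∘ D.Iso.from (component X)

EssentiallySurjective : ∀ {o ℓ e o′ ℓ′ e′} {𝓒 : Category o ℓ e} {𝓓 : Category o′ ℓ′ e′} →
                        Functor 𝓒 𝓓 → Set (o ⊔ o′ ⊔ ℓ′ ⊔ e′)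
EssentiallySurjective {𝓒 = 𝓒} {𝓓} F =
  ∀ Y → ∃[ X ] Category.Iso 𝓓 (Functor.F₀ F X) Y

module Fibres {o ℓ e o′ ℓ′ e′} {𝓔 : Category o′ ℓ′ e′} {𝓑 : Category o ℓ e}
              (p : Functor 𝓔 𝓑) where
  private
    module E = Category 𝓔
    module B = Category 𝓑
  open Functor p

  record ObjOver (A : B.Obj) : Set (o ⊔ o′) where
    constructor _lies_
    field
      obj  : E.Obj
      over : F₀ obj ≡ A
  open ObjOver public

  Over : ∀ {A B} (X : ObjOver A) (Y : ObjOver B) → A B.⇒ B → obj X E.⇒ obj Y → Set e
  Over X Y u f = subst₂ B._⇒_ (over X) (over Y) (F₁ f) B.≈ u

  Over-id : ∀ {A} (X : ObjOver A) → Over X X B.id E.id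
  Over-id (_ lies refl) = identity

  Over-∘ : ∀ {A B C} (X : ObjOver A) (Y : ObjOver B) (Z : ObjOver C)
           {u : A B.⇒ B} {v : B B.⇒ C} {f : obj X E.⇒ obj Y} {g : obj Y E.⇒ obj Z} →
           Over Y Z v g → Over X Y u f → Over X Z (v B.∘ u) (g E.∘ f)
  Over-∘ (_ lies refl) (_ lies refl) (_ lies refl) q r =
    B.Equiv.trans homomorphism (B.∘-resp-≈ q r)

  Over-resp : ∀ {A B} (X : ObjOver A) (Y : ObjOver B) {u v : A B.⇒ B}
              {f : obj X E.⇒ obj Y} → u B.≈ v → Over X Y u f → Over X Y v f
  Over-resp _ _ q r = B.Equiv.trans r q

  record Vertical {A : B.Obj} (X Y : ObjOver A) : Set (ℓ′ ⊔ e) where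
    constructor _vert_
    field
      arr     : obj X E.⇒ obj Y
      overid  : Over X Y B.id arr
  open Vertical public

  Fibre : B.Obj → Category (o ⊔ o′) (ℓ′ ⊔ e) e′
  Fibre A = record
    { Obj       = ObjOver A
    ; _⇒_       = Vertical
    ; _≈_       = λ f g → arr f E.≈ arr g
    ; id        = λ {X} → E.id vert Over-id X
    ; _∘_       = λ {X} {Y} {Z} g f →
                    (arr g E.∘ arr f) vert
                    Over-resp X Z B.identityˡ (Over-∘ X Y Z (overid g) (overid f))
    ; equiv     = record { refl = E.Equiv.refl ; sym = E.Equiv.sym ; trans = E.Equiv.trans }
    ; ∘-resp-≈  = E.∘-resp-≈
    ; assoc     = E.assoc
    ; identityˡ = E.identityˡ
    ; identityʳ = E.identityʳ
    }

  IsCartesian : ∀ {X Y} → X E.⇒ Y → Set (ℓ ⊔ e ⊔ o′ ⊔ ℓ′ ⊔ e′)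
  IsCartesian {X} {Y} f =
    ∀ {Z} (g : Z E.⇒ Y) (w : F₀ Z B.⇒ F₀ X) → F₁ f B.∘ w B.≈ F₁ g →
    Σ[ h ∈ Z E.⇒ X ] ((F₁ h B.≈ w) × (f E.∘ h E.≈ g)
      × (∀ (k : Z E.⇒ X) → F₁ k B.≈ w → f E.∘ k E.≈ g → k E.≈ h))

  record CartesianLifting {A B} (u : A B.⇒ B) (Y : ObjOver B) :
                          Set (o ⊔ ℓ ⊔ e ⊔ o′ ⊔ ℓ′ ⊔ e′) where
    field
      source    : ObjOver A
      lift      : obj source E.⇒ obj Y
      over-u    : Over source Y u lift
      cartesian : IsCartesian lift

  -- The universal property of a Cartesian arrow, with the equations between
  -- base objects carried along.
  factor : ∀ {A B C} (X : ObjOver A) (Y : ObjOver B) (Z : ObjOver C)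
           {u : A B.⇒ B} {v : C B.⇒ B} {f : obj X E.⇒ obj Y} → Over X Y u f → IsCartesian f →
           (g : obj Z E.⇒ obj Y) → Over Z Y v g → (w : C B.⇒ A) → u B.∘ w B.≈ v →
           Σ[ h ∈ obj Z E.⇒ obj X ] (Over Z X w h × (f E.∘ h E.≈ g)
             × (∀ k → Over Z X w k → f E.∘ k E.≈ g → k E.≈ h))
  factor (_ lies refl) (_ lies refl) (_ lies refl) f/u cart g g/v w uw≈v =
    cart g w (B.Equiv.trans (B.∘-resp-≈ f/u B.Equiv.refl)
               (B.Equiv.trans uw≈v (B.Equiv.sym g/v)))

-- The chosen lifting is a function of the arrow u itself and is not asked to
-- respect ≈; Cartesianness makes liftings along ≈-related arrows canonically
-- isomorphic.
record ClovenFibration {o ℓ e o′ ℓ′ e′} (𝓔 : Category o′ ℓ′ e′) (𝓑 : Category o ℓ e) :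
                       Set (o ⊔ ℓ ⊔ e ⊔ o′ ⊔ ℓ′ ⊔ e′) where
  private
    module E = Category 𝓔
    module B = Category 𝓑
  field
    functor : Functor 𝓔 𝓑
  open Fibres functor public
  field
    cleavage : ∀ {A B} (u : A B.⇒ B) (Y : ObjOver B) → CartesianLifting u Y

  private
    module L {A B} (u : A B.⇒ B) (Y : ObjOver B) = CartesianLifting (cleavage u Y)

    reindexHom : ∀ {A B} (u : A B.⇒ B) {X Y : ObjOver B} (k : Vertical X Y) →
                 Σ[ h ∈ obj (L.source u X) E.⇒ obj (L.source u Y) ]
                   (Over (L.source u X) (L.source u Y) B.id h
                   × (L.lift u Y E.∘ h E.≈ arr k E.∘ L.lift u X)
                   × (∀ m → Over (L.source u X) (L.source u Y) B.id m →
                        L.lift u Y E.∘ m E.≈ arr k E.∘ L.lift u X → m E.≈ h))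
    reindexHom u {X} {Y} k =
      factor (L.source u Y) Y (L.source u X) (L.over-u u Y) (L.cartesian u Y)
        (arr k E.∘ L.lift u X)
        (Over-resp (L.source u X) Y B.identityˡ
          (Over-∘ (L.source u X) X Y (overid k) (L.over-u u X)))
        B.id B.identityʳ

  reindex : ∀ {A B} → A B.⇒ B → Functor (Fibre B) (Fibre A)
  reindex {A} u = record
    { F₀           = L.source u
    ; F₁           = r₁
    ; F-resp-≈     = λ {X} {Y} {f} {g} f≈g →
        uniq g (r₁ f) (E.Equiv.trans (comm f) (E.∘-resp-≈ f≈g E.Equiv.refl))
    ; identity     = λ {X} → E.Equiv.sym (uniq (F.id {X}) (A/.id {L.source u X})
        (E.Equiv.trans E.identityʳ (E.Equiv.sym E.identityˡ)))
    ; homomorphism = λ {X} {Y} {Z} {f} {g} → E.Equiv.sym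
        (uniq (F._∘_ {X} {Y} {Z} g f)
          (A/._∘_ {L.source u X} {L.source u Y} {L.source u Z} (r₁ g) (r₁ f))
          (E.Equiv.trans (E.Equiv.sym E.assoc)
          (E.Equiv.trans (E.∘-resp-≈ (comm g) E.Equiv.refl)
          (E.Equiv.trans E.assoc
          (E.Equiv.trans (E.∘-resp-≈ E.Equiv.refl (comm f))
                         (E.Equiv.sym E.assoc))))))
    }
    where
    module F = Category (Fibre _)
    module A/ = Category (Fibre A)
    r₁ : ∀ {X Y} → Vertical X Y → Vertical (L.source u X) (L.source u Y)
    r₁ k = proj₁ (reindexHom u k) vert proj₁ (proj₂ (reindexHom u k))
    comm : ∀ {X Y} (k : Vertical X Y) →
           L.lift u Y E.∘ arr (r₁ k) E.≈ arr k E.∘ L.lift u X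
    comm k = proj₁ (proj₂ (proj₂ (reindexHom u k)))
    uniq : ∀ {X Y} (k : Vertical X Y) (m : Vertical (L.source u X) (L.source u Y)) →
           L.lift u Y E.∘ arr m E.≈ arr k E.∘ L.lift u X → arr m E.≈ arr (r₁ k)
    uniq k m = proj₂ (proj₂ (proj₂ (reindexHom u k))) (arr m) (overid m)

  infixl 8 _·_
  _·_ : ∀ {A B} → ObjOver B → A B.⇒ B → ObjOver A
  X · u = Functor.F₀ (reindex u) X

  infix 4 _≅_
  _≅_ : ∀ {A} → ObjOver A → ObjOver A → Set (ℓ′ ⊔ e ⊔ e′)
  _≅_ {A} = Category.Iso (Fibre A)

  module WeakEquality (products : BinaryProducts 𝓑) where
    open BinaryProducts products

    infix 4 _≋_
    _≋_ : ∀ {A B} → A B.⇒ B → A B.⇒ B → Set (o ⊔ e ⊔ o′ ⊔ ℓ′ ⊔ e′)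
    f ≋ f′ = NaturalIsomorphism (reindex ⟨ B.id , f ⟩) (reindex ⟨ B.id , f′ ⟩)

record CodeStructure {o ℓ e o′ ℓ′ e′} {𝓔 : Category o′ ℓ′ e′} {𝓑 : Category o ℓ e}
                     (p : ClovenFibration 𝓔 𝓑)
                     (products : BinaryProducts 𝓑) (terminal : Terminal 𝓑) :
                     Set (o ⊔ ℓ ⊔ e ⊔ o′ ⊔ ℓ′ ⊔ e′) where
  open Category 𝓑
  open BinaryProducts products
  open Terminal terminal
  open ClovenFibration p hiding (_≅_)
  open WeakEquality products
  field
    ⌜𝓔_⌝     : Obj → Obj
    ⌜_⌝ₒ     : ∀ {A} → ObjOver A → 𝟙 ⇒ ⌜𝓔 A ⌝

    ⌜𝓑[_,_]⌝ : Obj → Obj → Obj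
    ⌜_⌝ₘ     : ∀ {A B} → A ⇒ B → 𝟙 ⇒ ⌜𝓑[ A , B ]⌝
    ⌜⌝ₘ-resp-≈ : ∀ {A B} {f g : A ⇒ B} → f ≈ g → ⌜ f ⌝ₘ ≈ ⌜ g ⌝ₘ

    app      : ∀ A B → ⌜𝓔 B ⌝ ⊗ ⌜𝓑[ A , B ]⌝ ⇒ ⌜𝓔 A ⌝
    app-≋    : ∀ {A B} (X : ObjOver B) (f : A ⇒ B) →
               app A B ∘ ⟨ ⌜ X ⌝ₒ , ⌜ f ⌝ₘ ⟩ ≋ ⌜ X · f ⌝ₒ

    code     : ∀ A → ⌜𝓔 A ⌝ ⇒ ⌜𝓑[ 𝟙 , ⌜𝓔 A ⌝ ]⌝
    code-≋   : ∀ {A} (X : ObjOver A) → code A ∘ ⌜ X ⌝ₒ ≋ ⌜ ⌜ X ⌝ₒ ⌝ₘ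

record FibrationWithCodes (o ℓ e o′ ℓ′ e′ : Level) :
                          Set (lsuc (o ⊔ ℓ ⊔ e ⊔ o′ ⊔ ℓ′ ⊔ e′)) where
  field
    𝓑        : Category o ℓ e
    𝓔        : Category o′ ℓ′ e′
    products : BinaryProducts 𝓑
    terminal : Terminal 𝓑
    p        : ClovenFibration 𝓔 𝓑
    codes    : CodeStructure p products terminal
  open Category 𝓑 public using (Obj; _⇒_; _≈_; id; _∘_)
  open BinaryProducts products public
  open Terminal terminal public
  open ClovenFibration p public
  open WeakEquality products public
  open CodeStructure codes public

{-# OPTIONS --safe #-}

-- A diagonal argument.  There is d : ⌜𝓔 A ⌝ ⇒ ⌜𝓔 𝟙 ⌝ such that d ∘ ⌜ Q ⌝ is weakly
-- equal to the code of Q · i · ⌜ Q ⌝ for every Q over A.  Essential surjectivity of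
-- i* yields Q with Q · i ≅ P · d, and then X = Q · i · ⌜ Q ⌝ satisfies
-- X ≅ P · d · ⌜ Q ⌝ ≅ P · (d ∘ ⌜ Q ⌝) ≅ P · ⌜ X ⌝.
module Submission where

open import Level using (Level)
open import Data.Product using (Σ-syntax; _,_; proj₁; proj₂)
open import Relation.Binary.Bundles using (Setoid)
import Relation.Binary.Reasoning.Setoid as SetoidReasoning
open import Defs

module CategoryProperties {o ℓ e} (𝓒 : Category o ℓ e) where
  open Category 𝓒

  hom-setoid : Obj → Obj → Setoid ℓ e
  hom-setoid A B = record { Carrier = A ⇒ B ; _≈_ = _≈_ ; isEquivalence = equiv }

  module HomReasoning {A B : Obj} = SetoidReasoning (hom-setoid A B)

  ∘-resp-≈ˡ : ∀ {A B C} {g g′ : B ⇒ C} {f : A ⇒ B} → g ≈ g′ → g ∘ f ≈ g′ ∘ f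
  ∘-resp-≈ˡ g≈g′ = ∘-resp-≈ g≈g′ Equiv.refl

  ∘-resp-≈ʳ : ∀ {A B C} {g : B ⇒ C} {f f′ : A ⇒ B} → f ≈ f′ → g ∘ f ≈ g ∘ f′
  ∘-resp-≈ʳ = ∘-resp-≈ Equiv.refl

  cancel-inner : ∀ {A B C D} {h : C ⇒ D} {g : B ⇒ C} {g′ : C ⇒ B} {f : A ⇒ C} →
                 g ∘ g′ ≈ id → (h ∘ g) ∘ (g′ ∘ f) ≈ h ∘ f
  cancel-inner {h = h} {g} {g′} {f} gg′≈id = begin
    (h ∘ g) ∘ (g′ ∘ f) ≈⟨ assoc ⟩
    h ∘ (g ∘ (g′ ∘ f)) ≈⟨ ∘-resp-≈ʳ assoc ⟨
    h ∘ ((g ∘ g′) ∘ f) ≈⟨ ∘-resp-≈ʳ (∘-resp-≈ˡ gg′≈id) ⟩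
    h ∘ (id ∘ f)       ≈⟨ ∘-resp-≈ʳ identityˡ ⟩
    h ∘ f              ∎
    where open HomReasoning

  Iso-sym : ∀ {A B} → Iso A B → Iso B A
  Iso-sym i = record { from = to ; to = from ; isoˡ = isoʳ ; isoʳ = isoˡ }
    where open Iso i

  Iso-trans : ∀ {A B C} → Iso A B → Iso B C → Iso A C
  Iso-trans i j = record
    { from = J.from ∘ I.from
    ; to   = I.to ∘ J.to
    ; isoˡ = Equiv.trans (cancel-inner J.isoˡ) I.isoˡ
    ; isoʳ = Equiv.trans (cancel-inner I.isoʳ) J.isoʳ
    }
    where
    module I = Iso i
    module J = Iso j

module _ {o ℓ e o′ ℓ′ e′} {𝓒 : Category o ℓ e} {𝓓 : Category o′ ℓ′ e′} (F : Functor 𝓒 𝓓) where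
  private
    module C = Category 𝓒
    module D = Category 𝓓
  open Functor F

  F-resp-Iso : ∀ {X Y} → C.Iso X Y → D.Iso (F₀ X) (F₀ Y)
  F-resp-Iso i = record
    { from = F₁ from
    ; to   = F₁ to
    ; isoˡ = image isoˡ
    ; isoʳ = image isoʳ
    }
    where
    open C.Iso i
    image : ∀ {X Y} {g : Y C.⇒ X} {f : X C.⇒ Y} → g C.∘ f C.≈ C.id → F₁ g D.∘ F₁ f D.≈ D.id
    image gf≈id = D.Equiv.trans (D.Equiv.sym homomorphism)
                    (D.Equiv.trans (F-resp-≈ gf≈id) identity)

module ProductProperties {o ℓ e} {𝓒 : Category o ℓ e} (products : BinaryProducts 𝓒) where
  open Category 𝓒
  open BinaryProducts products
  open CategoryProperties 𝓒

  ⟨⟩-cong : ∀ {A B C} {f f′ : C ⇒ A} {g g′ : C ⇒ B} → f ≈ f′ → g ≈ g′ → ⟨ f , g ⟩ ≈ ⟨ f′ , g′ ⟩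
  ⟨⟩-cong f≈f′ g≈g′ = unique (Equiv.trans project₁ (Equiv.sym f≈f′))
                             (Equiv.trans project₂ (Equiv.sym g≈g′))

  ⟨⟩∘ : ∀ {A B C D} {f : C ⇒ A} {g : C ⇒ B} {h : D ⇒ C} → ⟨ f , g ⟩ ∘ h ≈ ⟨ f ∘ h , g ∘ h ⟩
  ⟨⟩∘ = Equiv.sym (unique (Equiv.trans (Equiv.sym assoc) (∘-resp-≈ˡ project₁))
                          (Equiv.trans (Equiv.sym assoc) (∘-resp-≈ˡ project₂)))

  -- Evaluates a binary operation whose two arguments depend on a parameter. The values of the
  -- arguments enter as premises, so that nested operations are evaluated by nested uses.
  ∘⟨⟩∘ : ∀ {A B C D E} {k : A ⊗ B ⇒ E} {f : C ⇒ A} {g : C ⇒ B} {h : D ⇒ C}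
         {f′ : D ⇒ A} {g′ : D ⇒ B} → f ∘ h ≈ f′ → g ∘ h ≈ g′ →
         (k ∘ ⟨ f , g ⟩) ∘ h ≈ k ∘ ⟨ f′ , g′ ⟩
  ∘⟨⟩∘ fh gh = Equiv.trans assoc (∘-resp-≈ʳ (Equiv.trans ⟨⟩∘ (⟨⟩-cong fh gh)))

module FibrationProperties {o ℓ e o′ ℓ′ e′} {𝓔 : Category o′ ℓ′ e′} {𝓑 : Category o ℓ e}
                           (p : ClovenFibration 𝓔 𝓑) where
  private
    module E = Category 𝓔
    module B = Category 𝓑
    module EP = CategoryProperties 𝓔
    module BP = CategoryProperties 𝓑
  open ClovenFibration p
  open Functor functor
  open CartesianLifting

  ≅-sym : ∀ {A} {X Y : ObjOver A} → X ≅ Y → Y ≅ X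
  ≅-sym {A} = CategoryProperties.Iso-sym (Fibre A)

  ≅-trans : ∀ {A} {X Y Z : ObjOver A} → X ≅ Y → Y ≅ Z → X ≅ Z
  ≅-trans {A} = CategoryProperties.Iso-trans (Fibre A)

  ·-resp-≅ : ∀ {A B} {X Y : ObjOver B} (u : A B.⇒ B) → X ≅ Y → X · u ≅ Y · u
  ·-resp-≅ u = F-resp-Iso (reindex u)

  module _ {A B} {u : A B.⇒ B} {X : ObjOver B} where

    lifting-comparison : (L M : CartesianLifting u X) →
      Σ[ h ∈ Vertical (source L) (source M) ] (lift M E.∘ arr h E.≈ lift L)
    lifting-comparison L M =
      let (h , h/id , Mh≈L , _) = factor (source M) X (source L) (over-u M) (cartesian M)
                                    (lift L) (over-u L) B.id B.identityʳ
      in (h vert h/id) , Mh≈L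

    -- Both `h` and the identity factor `lift L` through itself over the identity, and such a
    -- factorization is unique.
    lifting-endo-id : (L : CartesianLifting u X) (h : Vertical (source L) (source L)) →
      lift L E.∘ arr h E.≈ lift L → arr h E.≈ E.id
    lifting-endo-id L h Lh≈L =
      let (_ , _ , _ , uniq) = factor (source L) X (source L) (over-u L) (cartesian L)
                                 (lift L) (over-u L) B.id B.identityʳ
      in E.Equiv.trans (uniq (arr h) (overid h) Lh≈L)
           (E.Equiv.sym (uniq E.id (Over-id (source L)) E.identityʳ))

    -- Each lifting factors through the other over the identity; both round trips are vertical
    -- endomorphisms compatible with a lifting, hence identities.
    liftings-iso : (L M : CartesianLifting u X) → source L ≅ source M
    liftings-iso L M = record
      { from = proj₁ (lifting-comparison L M)
      ; to   = proj₁ (lifting-comparison M L)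
      ; isoˡ = round-trip L M
      ; isoʳ = round-trip M L
      }
      where
      round-trip : (L M : CartesianLifting u X) →
        arr (proj₁ (lifting-comparison M L)) E.∘ arr (proj₁ (lifting-comparison L M)) E.≈ E.id
      round-trip L M = lifting-endo-id L
        (Category._∘_ (Fibre A) {source L} {source M} {source L}
          (proj₁ (lifting-comparison M L)) (proj₁ (lifting-comparison L M)))
        (E.Equiv.trans (E.Equiv.sym E.assoc)
          (E.Equiv.trans (EP.∘-resp-≈ˡ (proj₂ (lifting-comparison M L)))
            (proj₂ (lifting-comparison L M))))

  -- Factor `k` through `g` over `F₁ f ∘ w`, then factor the result through `f` over `w`.
  ∘-cartesian : ∀ {X Y Z} {g : Y E.⇒ Z} {f : X E.⇒ Y} →
                IsCartesian g → IsCartesian f → IsCartesian (g E.∘ f)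
  ∘-cartesian {g = g} {f} g-cart f-cart k w gfw≈k =
    let (h , h/fw , gh≈k , h-uniq) = g-cart k (F₁ f B.∘ w) (begin
          F₁ g B.∘ (F₁ f B.∘ w) ≈⟨ B.assoc ⟨
          (F₁ g B.∘ F₁ f) B.∘ w ≈⟨ BP.∘-resp-≈ˡ homomorphism ⟨
          F₁ (g E.∘ f) B.∘ w    ≈⟨ gfw≈k ⟩
          F₁ k                  ∎)
        (j , j/w , fj≈h , j-uniq) = f-cart h w (B.Equiv.sym h/fw)
    in j , j/w ,
       E.Equiv.trans E.assoc (E.Equiv.trans (EP.∘-resp-≈ʳ fj≈h) gh≈k) ,
       -- A competitor `m` makes `f ∘ m` a factorization of `k` through `g`, which is therefore `h`;
       -- then `m` factors `h` through `f`.
       λ m m/w gfm≈k → j-uniq m m/w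
         (h-uniq (f E.∘ m)
           (B.Equiv.trans homomorphism (BP.∘-resp-≈ʳ m/w))
           (E.Equiv.trans (E.Equiv.sym E.assoc) gfm≈k))
    where open BP.HomReasoning

  -- The cleavage need not be split, so the composite of the two chosen liftings is only compared
  -- with the chosen lifting of the composite, up to vertical isomorphism.
  ·-∘ : ∀ {A B C} (X : ObjOver C) (u : B B.⇒ C) (v : A B.⇒ B) → X · u · v ≅ X · (u B.∘ v)
  ·-∘ X u v = liftings-iso composite (cleavage (u B.∘ v) X)
    where
    L = cleavage u X
    M = cleavage v (X · u)
    composite : CartesianLifting (u B.∘ v) X
    composite = record
      { source    = X · u · v
      ; lift      = lift L E.∘ lift M
      ; over-u    = Over-∘ (X · u · v) (X · u) X (over-u L) (over-u M)
      ; cartesian = ∘-cartesian (cartesian L) (cartesian M)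
      }

  -- A Cartesian lifting along `u` also lies over `v`, so it can be compared with the lifting chosen
  -- for `v`.
  ·-resp-≈ : ∀ {A B} (X : ObjOver B) {u v : A B.⇒ B} → u B.≈ v → X · u ≅ X · v
  ·-resp-≈ X {u} {v} u≈v = liftings-iso along-v (cleavage v X)
    where
    L = cleavage u X
    along-v : CartesianLifting v X
    along-v = record
      { source    = X · u
      ; lift      = lift L
      ; over-u    = Over-resp (X · u) X u≈v (over-u L)
      ; cartesian = cartesian L
      }

  module _ (products : BinaryProducts 𝓑) where
    open BinaryProducts products
    open WeakEquality products

    -- m is an arbitrary context in which f occurs, possibly depending on the parameter A.
    ·-resp-≋ : ∀ {A B C} {f f′ : A B.⇒ B} → f ≋ f′ → (X : ObjOver C) (m : A ⊗ B B.⇒ C)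
               {u u′ : A B.⇒ C} → m B.∘ ⟨ B.id , f ⟩ B.≈ u → m B.∘ ⟨ B.id , f′ ⟩ B.≈ u′ →
               X · u ≅ X · u′
    ·-resp-≋ {f = f} {f′} f≋f′ X m mf≈u mf′≈u′ =
      ≅-trans (≅-sym (≅-trans (·-∘ X m ⟨ B.id , f ⟩) (·-resp-≈ X mf≈u)))
        -- The context is absorbed into the object: the weak equality is evaluated at `X · m`, which
        -- lives over `A ⊗ B`.
        (≅-trans (NaturalIsomorphism.component f≋f′ (X · m))
          (≅-trans (·-∘ X m ⟨ B.id , f′ ⟩) (·-resp-≈ X mf′≈u′)))

module Diagonal {o ℓ e o′ ℓ′ e′} (𝓕 : FibrationWithCodes o ℓ e o′ ℓ′ e′) where
  open FibrationWithCodes 𝓕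
  open Category 𝓑 using (module Equiv; assoc; identityˡ; identityʳ)
  open CategoryProperties 𝓑
  open ProductProperties products
  open FibrationProperties p

  module _ {A : Obj} (i : ⌜𝓔 A ⌝ ⇒ A) where

    -- In element notation, x goes to app(app(x, `⌜ i ⌝ₘ`), code(x)): the object coded by x is
    -- reindexed along `i` and then along x itself. Here `code` turns x, the code of an object, into
    -- the code of a morphism out of `𝟙`, which makes the self-application possible.
    diagonal : ⌜𝓔 A ⌝ ⇒ ⌜𝓔 𝟙 ⌝
    diagonal = app 𝟙 ⌜𝓔 A ⌝ ∘ ⟨ app ⌜𝓔 A ⌝ A ∘ ⟨ id , ⌜ i ⌝ₘ ∘ ! ⟩ , code A ⟩

    -- After evaluation at `⌜ Q ⌝ₒ`, three weak equalities rewrite one subterm each: the inner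
    -- `app`, then `code`, then the outer `app`. The claim is about `P` reindexed because
    -- `·-resp-≋`, which allows rewriting inside a context, concludes there.
    ·-diagonal : (P : ObjOver ⌜𝓔 𝟙 ⌝) (Q : ObjOver A) →
                 P · (diagonal ∘ ⌜ Q ⌝ₒ) ≅ P · ⌜ Q · i · ⌜ Q ⌝ₒ ⌝ₒ
    ·-diagonal P Q =
      ≅-trans (·-resp-≈ P (∘⟨⟩∘ (∘⟨⟩∘ identityˡ const-∘) Equiv.refl))
      -- In each context `π₂` marks the subterm to be rewritten, while the argument left fixed is
      -- made constant by `π₁` into `𝟙`. The last context is `π₂` alone, as the whole term is then
      -- replaced.
      (≅-trans (·-resp-≋ products (app-≋ Q i) P (app 𝟙 ⌜𝓔 A ⌝ ∘ ⟨ π₂ , (code A ∘ ⌜ Q ⌝ₒ) ∘ π₁ ⟩)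
                 (∘⟨⟩∘ project₂ ∘π₁) (∘⟨⟩∘ project₂ ∘π₁))
      (≅-trans (·-resp-≋ products (code-≋ Q) P (app 𝟙 ⌜𝓔 A ⌝ ∘ ⟨ ⌜ Q · i ⌝ₒ ∘ π₁ , π₂ ⟩)
                 (∘⟨⟩∘ ∘π₁ project₂) (∘⟨⟩∘ ∘π₁ project₂))
               (·-resp-≋ products (app-≋ (Q · i) ⌜ Q ⌝ₒ) P π₂ project₂ project₂)))
      where
      const-∘ : (⌜ i ⌝ₘ ∘ !) ∘ ⌜ Q ⌝ₒ ≈ ⌜ i ⌝ₘ
      const-∘ = begin
        (⌜ i ⌝ₘ ∘ !) ∘ ⌜ Q ⌝ₒ ≈⟨ assoc ⟩
        ⌜ i ⌝ₘ ∘ (! ∘ ⌜ Q ⌝ₒ) ≈⟨ ∘-resp-≈ʳ (!-unique _) ⟨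
        ⌜ i ⌝ₘ ∘ !            ≈⟨ ∘-resp-≈ʳ (!-unique id) ⟩
        ⌜ i ⌝ₘ ∘ id           ≈⟨ identityʳ ⟩
        ⌜ i ⌝ₘ                ∎
        where open HomReasoning
      ∘π₁ : ∀ {B C} {g : 𝟙 ⇒ C} {f : 𝟙 ⇒ B} → (g ∘ π₁) ∘ ⟨ id , f ⟩ ≈ g
      ∘π₁ = Equiv.trans assoc (Equiv.trans (∘-resp-≈ʳ project₁) identityʳ)

theorem3p14 : ∀ {o ℓ e o′ ℓ′ e′ : Level} (𝓕 : FibrationWithCodes o ℓ e o′ ℓ′ e′) →
    let open FibrationWithCodes 𝓕 in
    (A : Obj) (i : ⌜𝓔 A ⌝ ⇒ A) → EssentiallySurjective (reindex i) →
    (P : ObjOver ⌜𝓔 𝟙 ⌝) → Σ[ X ∈ ObjOver 𝟙 ] (P · ⌜ X ⌝ₒ ≅ X)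
theorem3p14 𝓕 A i i*-surj P =
  let open FibrationWithCodes 𝓕
      open FibrationProperties p
      open Diagonal 𝓕
      (Q , Qi≅Pd) = i*-surj (P · diagonal i)
  in Q · i · ⌜ Q ⌝ₒ ,
     ≅-sym (≅-trans (·-resp-≅ ⌜ Q ⌝ₒ Qi≅Pd)
       (≅-trans (·-∘ P (diagonal i) ⌜ Q ⌝ₒ) (·-diagonal i P Q)))
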